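{- Let $U$ be an infinite set such that $|U| = \kappa$, $\aleph_0 \leq \kappa$. Then, for every $S \subseteq U$ such that $|S| < |U|$, there exists an injective function $\star_S : U^2 \to U$ such that $\mathit{fix}_\pi(\star_S) = S$.
   Context: For $\star : U^2 \to U$, the $\pi$-controlled fixpoints of $\star$ are $\mathit{fix}_\pi(\star) = \{u \in U \mid (\exists v \in U)(u \star v = u)\}$. -}

module Defs where

open import Level using (Level; _⊔_)
open import Data.Product using (Σ; ∃; _×_; _,_; proj₁)
open import Function.Bundles using (Injection; Bijection)
open import Relation.Binary.Bundles using (Setoid)
open import Relation.Binary.PropositionalEquality using (_≡_; setoid)
open import Relation.Nullary using (¬_)
open import Relation.Unary using (Pred)
import Relation.Binary.Construct.On as On

private
  variable
    a b c d : Level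

-- The elements of S are compared by their underlying element of U only, so
-- that S u having several proofs does not affect the cardinality of S.
⟪_⟫ : {U : Set a} → Pred U b → Setoid (a ⊔ b) a
⟪_⟫ {U = U} S = On.setoid {B = Σ U S} (setoid U) proj₁

infix 4 _≤ᶜ_ _≡ᶜ_ _<ᶜ_

_≤ᶜ_ : Setoid a b → Setoid c d → Set (a ⊔ b ⊔ c ⊔ d)
A ≤ᶜ B = Injection A B

_≡ᶜ_ : Setoid a b → Setoid c d → Set (a ⊔ b ⊔ c ⊔ d)
A ≡ᶜ B = Bijection A B

_<ᶜ_ : Setoid a b → Setoid c d → Set (a ⊔ b ⊔ c ⊔ d)
A <ᶜ B = A ≤ᶜ B × ¬ (A ≡ᶜ B)

fixπ : {U : Set a} → (U × U → U) → Pred U a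
fixπ _⋆_ u = ∃ λ v → _⋆_ (u , v) ≡ u

{-# OPTIONS --safe #-}
-- Excluded middle for all types, not only for propositions, chooses elements of
-- inhabited types, so Zorn's lemma holds and gives a maximal D ⊆ U, containing a
-- copy of ℕ, with an injection D² → D.  If D embedded in its complement, then the
-- injection could be extended to D together with its copy; so the complement
-- embeds in D, U embeds in D, and there is an injection p : U² → U.
-- If every row p(u , –) met S, choosing a point of S in each row would inject U
-- into S, whence |S| = |U| by Cantor–Bernstein.  So some row avoids S, and U,
-- hence also two copies of U², embeds in the complement of S.  Let j₀ and j₁ be
-- the embeddings of the two copies.  Put u ⋆ u = u for u ∈ S, and let every
-- other u ⋆ v be the first of j₀(u , v), j₁(u , v) that is different from u.
module Submission where

open import Defs
open import Axiom.ExcludedMiddle using (ExcludedMiddle)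
open import Axiom.Extensionality.Propositional using (Extensionality)
open import Data.Bool using (Bool; true; false; T)
open import Data.Bool.Properties using (T-irrelevant)
open import Data.Empty using (⊥; ⊥-elim)
open import Data.Nat using (ℕ; zero; suc; _*_)
open import Data.Nat.Properties using (even≢odd; *-cancelˡ-≡; suc-injective)
open import Data.Product using (Σ; ∃; _×_; _,_; proj₁; proj₂)
open import Data.Product.Function.NonDependent.Propositional using (_×-↣_)
open import Data.Sum using (_⊎_; inj₁; inj₂)
open import Data.Sum.Function.Propositional using (_⊎-↣_)
open import Function using (_∘_)
open import Function.Bundles using (Injection; _↣_; mk↣)
open import Function.Construct.Composition using (_↣-∘_)
open import Function.Construct.Identity using (↣-id)
open import Function.Definitions using (Injective)
open import Level using (Level; _⊔_)
open import Relation.Binary.PropositionalEquality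
  using (_≡_; _≢_; refl; sym; trans; cong; cong₂; subst; setoid)
open import Relation.Nullary using (¬_; Dec; yes; no; contradiction)
open import Relation.Nullary.Decidable using (isYes; toWitness; fromWitness)
open import Relation.Unary using (Pred; _≐_)

open Injection using (to; injective)

private
  variable
    a ℓ : Level
    A X : Set a

-- Pairing of natural numbers, and doubling from squaring.

pair : ℕ → ℕ → ℕ
pair zero    n = suc (2 * n)
pair (suc m) n = 2 * pair m n

-- `pair m n` is 2^m (2n + 1): parity tells whether the exponent is zero, and halving lowers it.
pair-injective : ∀ m n m′ n′ → pair m n ≡ pair m′ n′ → (m , n) ≡ (m′ , n′)
pair-injective zero n zero n′ eq =
  cong (zero ,_) (*-cancelˡ-≡ n n′ 2 (suc-injective eq))
pair-injective zero n (suc m′) n′ eq = contradiction (sym eq) (even≢odd (pair m′ n′) n)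
pair-injective (suc m) n zero n′ eq = contradiction eq (even≢odd (pair m n) n′)
pair-injective (suc m) n (suc m′) n′ eq =
  cong (λ (k , l) → suc k , l)
    (pair-injective m n m′ n′ (*-cancelˡ-≡ (pair m n) (pair m′ n′) 2 eq))

-- The two distinct elements tag the two copies, which become disjoint rows of the square.
doubling : (A × A) ↣ A → {x y : A} → x ≢ y → (A ⊎ A) ↣ A
doubling {A = A} p {x} {y} x≢y = mk↣ inj
  where
  tag : A ⊎ A → A × A
  tag (inj₁ z) = x , z
  tag (inj₂ z) = y , z

  tag-injective : Injective _≡_ _≡_ tag
  tag-injective {inj₁ _} {inj₁ _} eq = cong inj₁ (cong proj₂ eq)
  tag-injective {inj₁ _} {inj₂ _} eq = contradiction (cong proj₁ eq) x≢y
  tag-injective {inj₂ _} {inj₁ _} eq = contradiction (sym (cong proj₁ eq)) x≢y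
  tag-injective {inj₂ _} {inj₂ _} eq = cong inj₂ (cong proj₂ eq)

  inj : Injective _≡_ _≡_ (to p ∘ tag)
  inj = tag-injective ∘ injective p

-- Subsets, unions and chains.

-- With Boolean-valued predicates the subsets of X form a type in the universe
-- of X, and extensionality of functions makes inclusion antisymmetric.
𝓟 : Set a → Set a
𝓟 X = X → Bool

infix 4 _∈_ _⊆_

_∈_ : X → 𝓟 X → Set
x ∈ C = T (C x)

_⊆_ : 𝓟 X → 𝓟 X → Set _
C ⊆ D = ∀ {x} → x ∈ C → x ∈ D

El : {X : Set a} → 𝓟 X → Set a
El C = Σ _ (_∈ C)

El-≡ : (C : 𝓟 X) {x y : El C} → proj₁ x ≡ proj₁ y → x ≡ y
El-≡ C refl = cong (_ ,_) (T-irrelevant _ _)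

module Classical (em : ∀ {a} → ExcludedMiddle a) (ext : ∀ {a b} → Extensionality a b) where

  -- Pointwise decision turns a predicate of any level into a subset in the universe of `X`, which
  -- makes comprehension impredicative.
  ⟦_⟧ : Pred X ℓ → 𝓟 X
  ⟦ P ⟧ x = isYes (em {P = P x})

  ∈-intro : (P : Pred X ℓ) {x : X} → P x → x ∈ ⟦ P ⟧
  ∈-intro P {x} = fromWitness {a? = em {P = P x}}

  ∈-elim : (P : Pred X ℓ) {x : X} → x ∈ ⟦ P ⟧ → P x
  ∈-elim P {x} = toWitness {a? = em {P = P x}}

  ⊆-antisym : {C D : 𝓟 X} → C ⊆ D → D ⊆ C → C ≡ D
  ⊆-antisym {C = C} {D} C⊆D D⊆C = ext λ x → agree (C x) (D x) C⊆D D⊆C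
    where
    agree : ∀ c d → (T c → T d) → (T d → T c) → c ≡ d
    agree true  true  _ _ = refl
    agree true  false f _ = ⊥-elim (f _)
    agree false true  _ g = ⊥-elim (g _)
    agree false false _ _ = refl

  ∁ : 𝓟 X → 𝓟 X
  ∁ C = ⟦ (λ x → ¬ x ∈ C) ⟧

  InUnion : 𝓟 (𝓟 X) → Pred X _
  InUnion F x = ∃ λ C → C ∈ F × x ∈ C

  ⋃ : 𝓟 (𝓟 X) → 𝓟 X
  ⋃ F = ⟦ InUnion F ⟧

  IsChain : {X : Set a} → 𝓟 (𝓟 X) → Set a
  IsChain F = ∀ {C D} → C ∈ F → D ∈ F → C ⊆ D ⊎ D ⊆ C

  -- Zorn's lemma, by towers.

  module _
    {X : Set a} (Good : Pred (𝓟 X) ℓ) (bottom : 𝓟 X) (good-bottom : Good bottom)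
    (good-⋃ : ∀ F → ∃ (_∈ F) → IsChain F → (∀ {C} → C ∈ F → Good C) → Good (⋃ F))
    where

    ProperExtension : 𝓟 X → Pred (𝓟 X) _
    ProperExtension C D = Good D × C ⊆ D × ¬ D ⊆ C

    -- Excluded middle for the untruncated `∃` hands over an extension, so this is a choice
    -- function.
    step : 𝓟 X → 𝓟 X
    step C with em {P = ∃ (ProperExtension C)}
    ... | yes (D , _) = D
    ... | no _        = C

    step-increasing : ∀ C → C ⊆ step C
    step-increasing C with em {P = ∃ (ProperExtension C)}
    ... | yes (_ , _ , C⊆D , _) = C⊆D
    ... | no _                  = λ x∈C → x∈C

    step-good : ∀ C → Good C → Good (step C)
    step-good C good with em {P = ∃ (ProperExtension C)}
    ... | yes (_ , good′ , _) = good′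
    ... | no _                = good

    step-fixed⇒maximal : ∀ C → step C ⊆ C → ∀ D → Good D → C ⊆ D → D ⊆ C
    step-fixed⇒maximal C fixed D good C⊆D with em {P = ∃ (ProperExtension C)}
    ... | yes (_ , _ , _ , E⊈C) = contradiction (λ {x} → fixed {x}) E⊈C
    ... | no ¬proper with em {P = D ⊆ C}
    ...   | yes D⊆C = D⊆C
    ...   | no D⊈C  = contradiction (D , good , (λ {x} → C⊆D {x}) , D⊈C) ¬proper

    data Tower : 𝓟 X → Set a where
      start : Tower bottom
      next  : ∀ {C} → Tower C → Tower (step C)
      union : ∀ F → ∃ (_∈ F) → (∀ {C} → C ∈ F → Tower C) → Tower (⋃ F)

    bottom⊆ : ∀ {C} → Tower C → bottom ⊆ C
    bottom⊆ start                     x∈ = x∈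
    bottom⊆ (next {C} t)              x∈ = step-increasing C (bottom⊆ t x∈)
    bottom⊆ (union F (C , C∈F) tower) x∈ =
      ∈-intro (InUnion F) (C , C∈F , bottom⊆ (tower C∈F) x∈)

    -- Having `step D` in place of `D` says that no member lies strictly between the two, which
    -- carries the induction through `next`.
    compare : ∀ {C D} → Tower C → Tower D → C ⊆ D ⊎ step D ⊆ C
    compare start u = inj₁ (bottom⊆ u)
    compare {D = D} (next {C} t) u with compare t u
    ... | inj₂ D′⊆C = inj₂ λ x∈ → step-increasing C (D′⊆C x∈)
    -- With the roles exchanged, either `D` already contains `step C`, or `C` and `D` coincide.
    ... | inj₁ C⊆D with compare u t
    ...   | inj₂ C′⊆D = inj₁ C′⊆D
    -- `step` rests on a choice and need not respect mutual inclusion, so the sets are made equal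
    -- first.
    ...   | inj₁ D⊆C  = inj₂ λ {x} → subst (λ E → x ∈ step E) (⊆-antisym D⊆C C⊆D)
    compare {D = D} (union F _ tower) u
      with em {P = ∃ λ C → C ∈ F × step D ⊆ C}
    ... | yes (C , C∈F , D′⊆C) = inj₂ λ x∈ → ∈-intro (InUnion F) (C , C∈F , D′⊆C x∈)
    ... | no none = inj₁ λ x∈ → below (∈-elim (InUnion F) x∈)
      where
      below : ∀ {x} → InUnion F x → x ∈ D
      below (C , C∈F , x∈C) with compare (tower C∈F) u
      ... | inj₁ C⊆D  = C⊆D x∈C
      ... | inj₂ D′⊆C = contradiction (C , C∈F , λ {x} → D′⊆C {x}) none

    tower-good : ∀ {C} → Tower C → Good C
    tower-good start                    = good-bottom
    tower-good (next {C} t)             = step-good C (tower-good t)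
    tower-good (union F nonempty tower) =
      good-⋃ F nonempty chain (λ C∈F → tower-good (tower C∈F))
      where
      chain : IsChain F
      chain {C} {D} C∈F D∈F with compare (tower C∈F) (tower D∈F)
      ... | inj₁ C⊆D  = inj₁ C⊆D
      ... | inj₂ D′⊆C = inj₂ λ x∈ → D′⊆C (step-increasing D x∈)

    -- The union of the whole tower belongs to the tower, hence so does its `step`, which therefore
    -- lies inside that union.
    zorn : ∃ λ M → Good M × bottom ⊆ M × (∀ D → Good D → M ⊆ D → D ⊆ M)
    zorn = ⋃ F , tower-good top , bottom⊆ top , step-fixed⇒maximal (⋃ F) fixed
      where
      F : 𝓟 (𝓟 X)
      F = ⟦ Tower ⟧

      top : Tower (⋃ F)
      top = union F (bottom , ∈-intro Tower start) (∈-elim Tower)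

      fixed : step (⋃ F) ⊆ ⋃ F
      fixed x∈ = ∈-intro (InUnion F) (step (⋃ F) , ∈-intro Tower (next top) , x∈)

  -- Comparability of cardinalities.

  module _ {A B : Set a} where

    Matching : Pred (𝓟 (A × B)) a
    Matching M = ∀ {x y x′ y′} → (x , y) ∈ M → (x′ , y′) ∈ M →
      (x ≡ x′ → y ≡ y′) × (y ≡ y′ → x ≡ x′)

    matching-⋃ : ∀ F → ∃ (_∈ F) → IsChain F → (∀ {C} → C ∈ F → Matching C) → Matching (⋃ F)
    matching-⋃ F _ chain matching p∈ q∈
      with ∈-elim (InUnion F) p∈ | ∈-elim (InUnion F) q∈
    ... | C , C∈F , p∈C | D , D∈F , q∈D with chain C∈F D∈F
    ...   | inj₁ C⊆D = matching D∈F (C⊆D p∈C) q∈D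
    ...   | inj₂ D⊆C = matching C∈F p∈C (D⊆C q∈D)

    -- A maximal partial bijection is total on one side: were a point free on each side, matching
    -- the two would extend it.
    ↣-total : A ↣ B ⊎ B ↣ A
    ↣-total with zorn Matching (λ _ → false) (λ ()) matching-⋃
    ... | M , matching , _ , maximal
      with em {P = ∀ x → ∃ λ y → (x , y) ∈ M} | em {P = ∀ y → ∃ λ x → (x , y) ∈ M}
    ... | yes total | _ = inj₁ (mk↣ {to = proj₁ ∘ total}
            λ {x} {x′} → proj₂ (matching (proj₂ (total x)) (proj₂ (total x′))))
    ... | no _ | yes total = inj₂ (mk↣ {to = proj₁ ∘ total}
            λ {y} {y′} → proj₁ (matching (proj₂ (total y)) (proj₂ (total y′))))
    ... | no ¬total₁ | no ¬total₂ = ⊥-elim (¬total₁ λ x → totalAt x)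
      where
      module _ (x : A) (x-free : ¬ ∃ λ y → (x , y) ∈ M)
               (y : B) (y-free : ¬ ∃ λ x → (x , y) ∈ M) where

        Extended : Pred (A × B) a
        Extended p = p ∈ M ⊎ p ≡ (x , y)

        extended-matching : Matching ⟦ Extended ⟧
        extended-matching p∈ q∈ with ∈-elim Extended p∈ | ∈-elim Extended q∈
        ... | inj₁ p∈M  | inj₁ q∈M  = matching p∈M q∈M
        ... | inj₁ p∈M  | inj₂ refl =
          (λ { refl → contradiction (_ , p∈M) x-free }) ,
          (λ { refl → contradiction (_ , p∈M) y-free })
        ... | inj₂ refl | inj₁ q∈M  =
          (λ { refl → contradiction (_ , q∈M) x-free }) ,
          (λ { refl → contradiction (_ , q∈M) y-free })
        ... | inj₂ refl | inj₂ refl = (λ _ → refl) , (λ _ → refl)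

        not-both-free : ⊥
        not-both-free = x-free (y , maximal ⟦ Extended ⟧ extended-matching
          (λ p∈ → ∈-intro Extended (inj₁ p∈)) (∈-intro Extended (inj₂ refl)))

      totalAt : ∀ x → ∃ λ y → (x , y) ∈ M
      totalAt x with em {P = ∃ λ y → (x , y) ∈ M}
      ... | yes matched = matched
      ... | no x-free   = ⊥-elim (¬total₂ matchedAt)
        where
        matchedAt : ∀ y → ∃ λ x → (x , y) ∈ M
        matchedAt y with em {P = ∃ λ x → (x , y) ∈ M}
        ... | yes matched = matched
        ... | no y-free   = ⊥-elim (not-both-free x x-free y y-free)

  -- Embedding the square of an infinite set in the set.

  module _ {U : Set a} where

    -- A subset C of U ⊎ U³ encodes the set carrier C ⊆ U together with the graph
    -- of a multivalued operation on it.
    Graph : Set a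
    Graph = U ⊎ U × U × U

    carrier : 𝓟 Graph → 𝓟 U
    carrier C = C ∘ inj₁

    -- The graph may have several values z for the same (x , y), and values at
    -- points outside the carrier; both are harmless.
    record Pairing (C : 𝓟 Graph) : Set a where
      field
        closed : ∀ {x y z} → inj₂ (x , y , z) ∈ C → z ∈ carrier C
        total  : ∀ {x y} → x ∈ carrier C → y ∈ carrier C → ∃ λ z → inj₂ (x , y , z) ∈ C
        unique : ∀ {x y x′ y′ z} → inj₂ (x , y , z) ∈ C → inj₂ (x′ , y′ , z) ∈ C →
                 (x , y) ≡ (x′ , y′)

    open Pairing

    pairing-↣ : ∀ {C} → Pairing C → (El (carrier C) × El (carrier C)) ↣ El (carrier C)
    pairing-↣ {C} P = mk↣ {to = f} f-injective
      where
      f : El (carrier C) × El (carrier C) → El (carrier C)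
      f ((_ , x∈) , (_ , y∈)) = let z , r = total P x∈ y∈ in z , closed P r

      f-injective : Injective _≡_ _≡_ f
      f-injective {(_ , x∈) , (_ , y∈)} {(_ , x′∈) , (_ , y′∈)} eq =
        cong₂ _,_ (El-≡ (carrier C) (cong proj₁ same)) (El-≡ (carrier C) (cong proj₂ same))
        where
        same = unique P (proj₂ (total P x∈ y∈))
          (subst (λ z → inj₂ (_ , _ , z) ∈ C) (sym (cong proj₁ eq)) (proj₂ (total P x′∈ y′∈)))

    -- Each condition starts from at most two elements of the union, and in a chain these lie in one
    -- common member.
    pairing-⋃ : ∀ F → ∃ (_∈ F) → IsChain F → (∀ {C} → C ∈ F → Pairing C) → Pairing (⋃ F)
    pairing-⋃ F _ chain pairing = record
      { closed = λ r∈ → let C , C∈F , r∈C = ∈-elim (InUnion F) r∈ in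
                 ∈-intro (InUnion F) (C , C∈F , closed (pairing C∈F) r∈C)
      ; total  = λ x∈ y∈ →
                 let C , C∈F , x∈C , y∈C = common x∈ y∈
                     z , r = total (pairing C∈F) x∈C y∈C
                 in z , ∈-intro (InUnion F) (C , C∈F , r)
      ; unique = λ r∈ r′∈ → let C , C∈F , r∈C , r′∈C = common r∈ r′∈ in
                 unique (pairing C∈F) r∈C r′∈C
      }
      where
      common : ∀ {p q} → p ∈ ⋃ F → q ∈ ⋃ F → ∃ λ C → C ∈ F × p ∈ C × q ∈ C
      common p∈ q∈ with ∈-elim (InUnion F) p∈ | ∈-elim (InUnion F) q∈
      ... | C , C∈F , p∈C | D , D∈F , q∈D with chain C∈F D∈F
      ...   | inj₁ C⊆D = D , D∈F , C⊆D p∈C , q∈D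
      ...   | inj₂ D⊆C = C , C∈F , p∈C , D⊆C q∈D

    module _ (i : ℕ ↣ U) where

      Countable : Pred Graph a
      Countable (inj₁ x)           = ∃ λ m → to i m ≡ x
      Countable (inj₂ (x , y , z)) =
        ∃ λ m → ∃ λ n → (to i m , to i n) ≡ (x , y) × to i (pair m n) ≡ z

      -- This is `pair` transported along `i`. Starting Zorn's lemma here puts two distinct points
      -- in the maximal carrier, as `doubling` requires.
      countable-pairing : Pairing ⟦ Countable ⟧
      countable-pairing = record
        { closed = λ r∈ → let m , n , _ , eq = ∈-elim Countable {inj₂ _} r∈ in
                   ∈-intro Countable {inj₁ _} (pair m n , eq)
        ; total  = λ x∈ y∈ →
                   let m , x≡ = ∈-elim Countable {inj₁ _} x∈
                       n , y≡ = ∈-elim Countable {inj₁ _} y∈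
                   in to i (pair m n) , ∈-intro Countable {inj₂ _} (m , n , cong₂ _,_ x≡ y≡ , refl)
        ; unique = λ r∈ r′∈ →
                   let m  , n  , xy≡  , z≡  = ∈-elim Countable {inj₂ _} r∈
                       m′ , n′ , xy≡′ , z≡′ = ∈-elim Countable {inj₂ _} r′∈
                       mn≡ = pair-injective m n m′ n′ (injective i (trans z≡ (sym z≡′)))
                   in trans (sym xy≡) (trans (cong (λ (k , l) → to i k , to i l) mn≡) xy≡′)
        }

    module _ {C : 𝓟 Graph} (P : Pairing C)
             (double : (El (carrier C) ⊎ El (carrier C)) ↣ El (carrier C))
             (e : El (carrier C) ↣ El (∁ (carrier C))) where

      InWider : Pred U a
      InWider x = x ∈ carrier C ⊎ ∃ λ c → proj₁ (to e c) ≡ x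

      Wider : Set a
      Wider = El ⟦ InWider ⟧

      wider-⊎ : Wider ↣ (El (carrier C) ⊎ El (carrier C))
      wider-⊎ = mk↣ {to = λ (_ , x∈) → side (∈-elim InWider x∈)}
        λ {(_ , x∈)} {(_ , y∈)} eq →
          El-≡ ⟦ InWider ⟧ (side-injective (∈-elim InWider x∈) (∈-elim InWider y∈) eq)
        where
        side : ∀ {x} → InWider x → El (carrier C) ⊎ El (carrier C)
        side (inj₁ x∈)      = inj₁ (_ , x∈)
        side (inj₂ (c , _)) = inj₂ c

        side-injective : ∀ {x y} (p : InWider x) (q : InWider y) → side p ≡ side q → x ≡ y
        side-injective (inj₁ _)          (inj₁ _)           refl = refl
        side-injective (inj₂ (_ , refl)) (inj₂ (_ , refl)) refl = refl

      wider : Wider ↣ El (carrier C)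
      wider = double ↣-∘ wider-⊎

      -- The wider set and its square fit into the old carrier; `e` then moves the values off it
      -- while keeping them in the wider set, so they cannot meet old values.
      new-↣ : (Wider × Wider) ↣ El (∁ (carrier C))
      new-↣ = e ↣-∘ (pairing-↣ P ↣-∘ (wider ×-↣ wider))

      -- Every pair from the wider set receives a new value, even one that had a value in `C`; here
      -- a pair may come to have several.
      Extension : Pred Graph a
      Extension (inj₁ x)           = InWider x
      Extension (inj₂ (x , y , z)) = inj₂ (x , y , z) ∈ C ⊎
        ∃ λ (p : Wider × Wider) → (proj₁ (proj₁ p) , proj₁ (proj₂ p)) ≡ (x , y) ×
          proj₁ (to new-↣ p) ≡ z

      extension-pairing : Pairing ⟦ Extension ⟧
      extension-pairing = record
        { closed = λ r∈ → ∈-intro Extension {inj₁ _} (closed′ (∈-elim Extension {inj₂ _} r∈))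
        ; total  = λ x∈ y∈ →
                   let p = (_ , ∈-intro InWider (∈-elim Extension {inj₁ _} x∈)) ,
                           (_ , ∈-intro InWider (∈-elim Extension {inj₁ _} y∈))
                   in proj₁ (to new-↣ p) , ∈-intro Extension {inj₂ _} (inj₂ (p , refl , refl))
        ; unique = λ r∈ r′∈ → unique′ (∈-elim Extension {inj₂ _} r∈) (∈-elim Extension {inj₂ _} r′∈)
        }
        where
        closed′ : ∀ {x y z} → Extension (inj₂ (x , y , z)) → Extension (inj₁ z)
        closed′ (inj₁ r∈C)             = inj₁ (closed P r∈C)
        closed′ (inj₂ (_ , _ , refl)) = inj₂ (_ , refl)

        fresh : ∀ p {x y} → ¬ inj₂ (x , y , proj₁ (to new-↣ p)) ∈ C
        fresh p r∈C = ∈-elim (λ x → ¬ x ∈ carrier C) (proj₂ (to new-↣ p)) (closed P r∈C)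

        unique′ : ∀ {x y x′ y′ z} → Extension (inj₂ (x , y , z)) →
                  Extension (inj₂ (x′ , y′ , z)) → (x , y) ≡ (x′ , y′)
        unique′ (inj₁ r∈C)               (inj₁ r′∈C)             = unique P r∈C r′∈C
        unique′ (inj₁ r∈C)               (inj₂ (p , _ , refl))   = contradiction r∈C (fresh p)
        unique′ (inj₂ (p , _ , refl))    (inj₁ r′∈C)             = contradiction r′∈C (fresh p)
        unique′ (inj₂ (p , refl , refl)) (inj₂ (p′ , refl , eq)) =
          cong (λ (x , y) → proj₁ x , proj₁ y)
            (injective new-↣ (El-≡ (∁ (carrier C)) (sym eq)))

    split : (D : 𝓟 U) → U ↣ (El D ⊎ El (∁ D))
    split D = mk↣ {to = side ∘ decide} λ {x} {y} → side-injective (decide x) (decide y)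
      where
      side : ∀ {x} → x ∈ D ⊎ x ∈ ∁ D → El D ⊎ El (∁ D)
      side (inj₁ x∈) = inj₁ (_ , x∈)
      side (inj₂ x∉) = inj₂ (_ , x∉)

      decide : ∀ x → x ∈ D ⊎ x ∈ ∁ D
      decide x with em {P = x ∈ D}
      ... | yes x∈ = inj₁ x∈
      ... | no x∉  = inj₂ (∈-intro (λ x → ¬ x ∈ D) x∉)

      side-injective : ∀ {x y} (p : x ∈ D ⊎ x ∈ ∁ D) (q : y ∈ D ⊎ y ∈ ∁ D) →
                       side p ≡ side q → x ≡ y
      side-injective (inj₁ _) (inj₁ _) refl = refl
      side-injective (inj₂ _) (inj₂ _) refl = refl

    square : ℕ ↣ U → (U × U) ↣ U
    square i with zorn Pairing ⟦ Countable i ⟧ (countable-pairing i) pairing-⋃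
    ... | M , P , countable⊆ , maximal = conclude ↣-total
      where
      D : 𝓟 U
      D = carrier M

      point : ℕ → El D
      point n = to i n , countable⊆ (∈-intro (Countable i) {inj₁ _} (n , refl))

      double : (El D ⊎ El D) ↣ El D
      double = doubling (pairing-↣ P) {point 0} {point 1}
        λ eq → contradiction (injective i (cong proj₁ eq)) λ ()

      conclude : El D ↣ El (∁ D) ⊎ El (∁ D) ↣ El D → (U × U) ↣ U
      -- The extension contains the image of `point 0`, which lies outside `D`, against maximality.
      conclude (inj₁ e) = ⊥-elim (∈-elim (λ x → ¬ x ∈ D) (proj₂ (to e (point 0)))
        (maximal ⟦ Extension P double e ⟧ (extension-pairing P double e) M⊆
          (∈-intro (Extension P double e) {inj₁ _} (inj₂ (point 0 , refl)))))
        where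
        M⊆ : M ⊆ ⟦ Extension P double e ⟧
        M⊆ {inj₁ _} x∈ = ∈-intro (Extension P double e) {inj₁ _} (inj₁ x∈)
        M⊆ {inj₂ _} r∈ = ∈-intro (Extension P double e) {inj₂ _} (inj₁ r∈)
      conclude (inj₂ e) = mk↣ (El-≡ D) ↣-∘ (pairing-↣ P ↣-∘ (k ×-↣ k))
        where
        k : U ↣ El D
        k = double ↣-∘ ((↣-id _ ⊎-↣ e) ↣-∘ split D)

    -- Cantor-Bernstein, and a row outside `S`.

    module _ (S : Pred U ℓ) where

      module _ (f : U ↣ U) (f-in-S : ∀ x → S (to f x)) where

        data Orbit : U → Set (a ⊔ ℓ) where
          start : ∀ {x} → ¬ S x → Orbit x
          next  : ∀ {x} → Orbit x → Orbit (to f x)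

        -- The graph of the Cantor–Bernstein bijection from S to U, which undoes f
        -- on the orbits of the points outside S and fixes all other points.
        Link : U → U → Set (a ⊔ ℓ)
        Link s x = Orbit x × to f x ≡ s ⊎ ¬ Orbit s × x ≡ s

        link-total : ∀ s → S s → ∃ (Link s)
        link-total s s∈S with em {P = Orbit s}
        ... | no ¬orbit              = s , inj₂ (¬orbit , refl)
        ... | yes (start s∉S)        = contradiction s∈S s∉S
        ... | yes (next {x} x-orbit) = x , inj₁ (x-orbit , refl)

        link-surjective : ∀ x → ∃ λ s → S s × Link s x
        link-surjective x with em {P = Orbit x} | em {P = S x}
        ... | yes orbit | _       = to f x , f-in-S x , inj₁ (orbit , refl)
        ... | no ¬orbit | yes x∈S = x , x∈S , inj₂ (¬orbit , refl)
        ... | no ¬orbit | no x∉S  = contradiction (start x∉S) ¬orbit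

        link-functional : ∀ {s x y} → Link s x → Link s y → x ≡ y
        link-functional (inj₁ (_ , eq))       (inj₁ (_ , eq′))      = injective f (trans eq (sym eq′))
        link-functional (inj₁ (orbit , refl)) (inj₂ (¬orbit , _))   = contradiction (next orbit) ¬orbit
        link-functional (inj₂ (¬orbit , _))   (inj₁ (orbit , refl)) = contradiction (next orbit) ¬orbit
        link-functional (inj₂ (_ , refl))     (inj₂ (_ , refl))     = refl

        link-injective : ∀ {s t x} → Link s x → Link t x → s ≡ t
        link-injective (inj₁ (_ , refl))      (inj₁ (_ , refl))      = refl
        link-injective (inj₁ (orbit , _))     (inj₂ (¬orbit , refl)) = contradiction orbit ¬orbit
        link-injective (inj₂ (¬orbit , refl)) (inj₁ (orbit , _))     = contradiction orbit ¬orbit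
        link-injective (inj₂ (_ , refl))      (inj₂ (_ , refl))      = refl

        cantor-bernstein : ⟪ S ⟫ ≡ᶜ setoid U
        cantor-bernstein = record
          { to        = λ (s , s∈S) → proj₁ (link-total s s∈S)
          -- The chosen link may depend on the proof of `S s`; functionality of `Link` removes the
          -- dependence.
          ; cong      = λ { {s , s∈S} {_ , t∈S} refl →
                        link-functional (proj₂ (link-total s s∈S)) (proj₂ (link-total s t∈S)) }
          ; bijective =
              (λ { {s , s∈S} {t , t∈S} eq → link-injective (proj₂ (link-total s s∈S))
                   (subst (Link t) (sym eq) (proj₂ (link-total t t∈S))) }) ,
              (λ x → let s , s∈S , link = link-surjective x in
                (s , s∈S) , λ { {_ , t∈S} refl → link-functional (proj₂ (link-total s t∈S)) link })
          }

      avoid : ¬ (⟪ S ⟫ ≡ᶜ setoid U) → (U × U) ↣ U → Σ (U ↣ U) λ k → ∀ x → ¬ S (to k x)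
      avoid S≢U p with em {P = ∃ λ x → ∀ y → ¬ S (to p (x , y))}
      ... | yes (x , free) = mk↣ {to = λ y → to p (x , y)} (λ eq → cong proj₂ (injective p eq)) , free
      ... | no none = contradiction
              -- Distinct rows are disjoint by injectivity of `p`, so any choice of points in them
              -- is injective.
              (cantor-bernstein (mk↣ {to = λ x → to p (x , proj₁ (meet x))}
                (λ eq → cong proj₁ (injective p eq))) (proj₂ ∘ meet))
              S≢U
        where
        meet : ∀ x → ∃ λ y → S (to p (x , y))
        meet x with em {P = ∃ λ y → S (to p (x , y))}
        ... | yes met  = met
        ... | no unmet = contradiction (x , λ y s → unmet (y , s)) none

      -- The operation with fixpoint set `S`.

      module _ (j : ((U × U) ⊎ (U × U)) ↣ U) (j∉S : ∀ p → ¬ S (to j p)) where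

        -- The two copies of `(u , v)` have different images, so at most one image is `u`. The last
        -- component keeps the source for `star-injective`.
        moving : ∀ u v → ∃ λ p → to j p ≢ u × (p ≡ inj₁ (u , v) ⊎ p ≡ inj₂ (u , v))
        moving u v with em {P = to j (inj₁ (u , v)) ≡ u}
        ... | no moved = inj₁ (u , v) , moved , inj₁ refl
        ... | yes eq   = inj₂ (u , v) ,
          (λ eq′ → contradiction (injective j (trans eq (sym eq′))) λ ()) , inj₂ refl

        Diagonal : U × U → Set (a ⊔ ℓ)
        Diagonal (u , v) = S u × u ≡ v

        -- The decision is an argument so that proofs can split on it; `em` is supplied at the end.
        star : (q : U × U) → Dec (Diagonal q) → U
        star (u , v) (yes _) = u
        star (u , v) (no _)  = to j (proj₁ (moving u v))

        -- Diagonal values lie in `S` and all others outside, so mixed cases are impossible; off the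
        -- diagonal, either copy determines the pair.
        star-injective : ∀ q q′ d d′ → star q d ≡ star q′ d′ → q ≡ q′
        star-injective _ _ (yes (_ , refl)) (yes (_ , refl)) refl = refl
        star-injective _ _ (yes (u∈S , _))  (no _)           eq   =
          contradiction (subst S eq u∈S) (j∉S _)
        star-injective _ _ (no _)           (yes (u∈S , _))  eq   =
          contradiction (subst S (sym eq) u∈S) (j∉S _)
        star-injective (u , v) (u′ , v′) (no _) (no _) eq
          with moving u v | moving u′ v′
        ... | p , _ , src | p′ , _ , src′ = sources src src′ (injective j eq)
          where
          sources : ∀ {q q′ : U × U} {p p′} → p ≡ inj₁ q ⊎ p ≡ inj₂ q →
                    p′ ≡ inj₁ q′ ⊎ p′ ≡ inj₂ q′ → p ≡ p′ → q ≡ q′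
          sources (inj₁ refl) (inj₁ refl) refl = refl
          sources (inj₂ refl) (inj₂ refl) refl = refl

        star-fixed⇒S : ∀ u v d → star (u , v) d ≡ u → S u
        star-fixed⇒S u v (yes (u∈S , _)) _  = u∈S
        star-fixed⇒S u v (no _)          eq = contradiction eq (proj₁ (proj₂ (moving u v)))

        star-diagonal : ∀ u d → S u → star (u , u) d ≡ u
        star-diagonal u (yes _)    _   = refl
        star-diagonal u (no ¬diag) u∈S = contradiction (u∈S , refl) ¬diag

proposition16 : (∀ {a} → ExcludedMiddle a) → (∀ {a b} → Extensionality a b) →
    ∀ {u ℓ} (U : Set u) → setoid ℕ ≤ᶜ setoid U →
    (S : Pred U ℓ) → ⟪ S ⟫ <ᶜ setoid U →
    Σ (U × U → U) λ ⋆ → Injective _≡_ _≡_ ⋆ × fixπ ⋆ ≐ S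
proposition16 em ext U i S (_ , S≢U) =
  (λ q → star S j j∉S q em) ,
  (λ {q} {q′} → star-injective S j j∉S q q′ em em) ,
  (λ {u} (v , eq) → star-fixed⇒S S j j∉S u v em eq) ,
  (λ {u} u∈S → u , star-diagonal S j j∉S u em u∈S)
  where
  open Classical em ext

  p : (U × U) ↣ U
  p = square i

  k : Σ (U ↣ U) λ k → ∀ x → ¬ S (to k x)
  k = avoid S S≢U p

  double : (U ⊎ U) ↣ U
  double = doubling p {to i 0} {to i 1} λ eq → contradiction (injective i eq) λ ()

  j : ((U × U) ⊎ (U × U)) ↣ U
  -- `k` is applied last, so all values lie outside `S`.
  j = proj₁ k ↣-∘ (double ↣-∘ (p ⊎-↣ p))

  j∉S : ∀ q → ¬ S (to j q)
  j∉S _ = proj₂ k _
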